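{- Let $n\ge3$ be odd. There is a statistics-preserving bijection $$\Phi:\operatorname{Deo}^{\max}_{f_{2,n}}\to\operatorname{Dyck}_{2,n},$$ that is, a bijection with $\mathtt{area}(\Phi(D))=\mathtt{area}(D)$ and $\mathtt{dinv}(\Phi(D))=\mathtt{dinv}(D)$ for all $D$. Moreover, rotation by $180^\circ$ is a statistics-reversing bijection $\mathbf{rot}:\operatorname{Deo}^{\max}_{f_{2,n}}\to\operatorname{Deo}^{\max}_{f_{2,n}}$, that is, $(\mathtt{area}(D),\mathtt{dinv}(D))=(\mathtt{dinv}(\mathbf{rot}(D)),\mathtt{area}(\mathbf{rot}(D)))$ for all $D$.
   Context: $f_{2,n}$ is the bounded affine permutation $i\mapsto i+2$. The set $\operatorname{Deo}^{\max}_{f_{2,n}}$ of maximal $f_{2,n}$-Deograms consists of the fillings $D$ of the boxes of a rectangle with $2$ rows and $n-2$ columns by crossings and elbows satisfying the following. Label the unit edges of the northwest boundary by $1,\dots,n$ (left side from bottom to top: $1,2$; then top side from left to right: $3,\dots,n$), and those of the southeast boundary by $1,\dots,n$ (bottom side from left to right: $1,\dots,n-2$; then right side from bottom to top: $n-1,n$). Strands enter at the northwest boundary and travel right/down: in a crossing, left goes to right and top goes to bottom; in an elbow, a strand entering from the left exits at the bottom and one entering from the top exits right. The conditions are: (1) the strand entering at $i$ exits at $i$ for all $i\in[n]$; (2) (distinguished) whenever two strands form an elbow in a box, they have crossed an even number of times before it (counting from the northwest boundary); (3) $D$ has exactly $n-1$ elbows. Each $D\in\operatorname{Deo}^{\max}_{f_{2,n}}$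 has a unique column, denoted $\operatorname{col}(D)$, both of whose boxes are elbows. $\mathtt{area}(D)$ is the number of elbows to the right of the top elbow of $\operatorname{col}(D)$ (in the top row), and $\mathtt{dinv}(D)$ is the number of elbows to the left of the bottom elbow of $\operatorname{col}(D)$ (in the bottom row). $\operatorname{Dyck}_{2,n}$ is the set of lattice paths with unit up and right steps from $(0,0)$ to $(n-2,2)$ that never go below the diagonal from $(0,0)$ to $(n-2,2)$. For such a path, $\mathtt{area}$ is the number of full unit boxes lying between the path and the diagonal, and $\mathtt{dinv}$ is the usual rational Dyck path statistic: the number of boxes $b$ of the rectangle lying above (northwest of) the path such that $\frac{\mathrm{arm}(b)}{\mathrm{leg}(b)+1}<\frac{n-2}{2}<\frac{\mathrm{arm}(b)+1}{\mathrm{leg}(b)}$ (the right inequality is vacuous when $\mathrm{leg}(b)=0$), where $\mathrm{arm}(b)$, $\mathrm{leg}(b)$ are the numbers of boxes above the path strictly to the right of $b$ in its row, respectively strictly below $b$ in its column. For $2$-row paths this is simply the number of boxes above the path. -}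

module Defs where

open import Data.Empty using (⊥-elim)
open import Data.Fin using (Fin; zero; suc; toℕ; _<?_; _≤?_)
open import Data.List using (List; []; _∷_; _++_)
open import Data.Nat using (ℕ; zero; suc; _+_; _*_; _∸_; _≤_; _<_; z≤n; s≤s)
import Data.Nat as ℕ
open import Data.Nat.Divisibility using (_∣_)
open import Data.Nat.Properties
  using (+-suc; +-comm; +-mono-≤; suc-injective; m+1+n≢m; m≤n+m; 1+n≰n;
         ≤-reflexive; ≤-trans; ≤-pred)
open import Data.Product using (∃; ∃!; _×_; _,_; proj₁; proj₂; swap)
open import Data.Product.Properties using (≡-dec)
open import Data.Sum using (_⊎_)
open import Data.Vec using (Vec; []; _∷_; lookup; zipWith; tabulate; allFin; sum; count; map; reverse)
open import Level using (0ℓ)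
open import Relation.Binary using (Setoid; DecidableEquality)
import Relation.Binary.Construct.On as On
open import Relation.Binary.PropositionalEquality
  using (_≡_; refl; sym; trans; cong; subst; setoid)
open import Relation.Nullary using (Dec; yes; no; ¬_)
open import Relation.Nullary.Decidable using (_×-dec_; _⊎-dec_)
open import Relation.Unary using (Pred; Decidable)

private
  variable
    m k : ℕ

-- Throughout, m is the number of columns of the rectangle, m = n − 2.
-- A box is a pair (column , row).  Columns are numbered from left to right.
-- Rows are numbered from the top for fillings (row 0 is the top row), but from
-- the bottom for lattice paths (row 0 lies between heights 0 and 1).

Box : ℕ → Set
Box m = Fin m × Fin 2

#Fin : {P : Pred (Fin k) 0ℓ} → Decidable P → ℕ
#Fin P? = count P? (allFin _)

#Box : {P : Pred (Box m) 0ℓ} → Decidable P → ℕ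
#Box P? = sum (tabulate λ c → #Fin λ r → P? (c , r))

data Tile : Set where
  crossing elbow : Tile

infix 4 _≟ᵗ_
_≟ᵗ_ : DecidableEquality Tile
crossing ≟ᵗ crossing = yes refl
crossing ≟ᵗ elbow    = no λ ()
elbow    ≟ᵗ crossing = no λ ()
elbow    ≟ᵗ elbow    = yes refl

-- The columns from left to right, each read from top to bottom.
Filling : ℕ → Set
Filling m = Vec (Vec Tile 2) m

tile : Filling m → Box m → Tile
tile D (c , r) = lookup (lookup D c) r

pattern top    = zero
pattern bottom = suc zero

rotate180 : Filling m → Filling m
rotate180 D = reverse (map reverse D)

-- A strand is named by the label, in {1,…,n}, of the boundary edge where it
-- enters.
Strand : Set
Strand = ℕ

-- The strands leaving a box, given the tile and the strands entering from the
-- left and from the top.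
exitRight exitBottom : Tile → Strand × Strand → Strand
exitRight  crossing (l , t) = l
exitRight  elbow    (l , t) = t
exitBottom crossing (l , t) = t
exitBottom elbow    (l , t) = l

-- The strands (from the left , from the top) entering each box of one column,
-- where ls are the strands entering the column from the left, and t is the one
-- entering it from above.
columnEntries : Vec Tile k → Vec Strand k → Strand → Vec (Strand × Strand) k
columnEntries []       []       t = []
columnEntries (T ∷ Ts) (l ∷ ls) t =
  (l , t) ∷ columnEntries Ts ls (exitBottom T (l , t))

columnRight : Vec Tile k → Vec Strand k → Strand → Vec Strand k
columnRight Ts ls t = zipWith exitRight Ts (columnEntries Ts ls t)

-- The columns are traversed from left to right: ls are the strands on the
-- current vertical line, and t, t + 1, … those above the remaining columns.
entriesFrom : Vec Strand 2 → Strand → Filling m → Vec (Vec (Strand × Strand) 2) m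
entriesFrom ls t []       = []
entriesFrom ls t (Ts ∷ D) =
  columnEntries Ts ls t ∷ entriesFrom (columnRight Ts ls t) (suc t) D

rightFrom : Vec Strand 2 → Strand → Filling m → Vec Strand 2
rightFrom ls t []       = ls
rightFrom ls t (Ts ∷ D) = rightFrom (columnRight Ts ls t) (suc t) D

-- Northwest labels: the left side carries 2 (top row) and 1 (bottom row), the
-- top side carries 3, 4, ….
leftLabels : Vec Strand 2
leftLabels = 2 ∷ 1 ∷ []

entries : (D : Filling m) → Box m → Strand × Strand
entries D (c , r) = lookup (lookup (entriesFrom leftLabels 3 D) c) r

bottomExit : Filling m → Fin m → Strand
bottomExit D c = exitBottom (tile D (c , bottom)) (entries D (c , bottom))

rightExit : Filling m → Fin 2 → Strand
rightExit D r = lookup (rightFrom leftLabels 3 D) r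

-- Southeast labels: 1,…,n−2 along the bottom side, then n−1 (bottom row) and
-- n (top row) on the right side.
bottomLabel : Fin m → Strand
bottomLabel c = suc (toℕ c)

rightLabel : ℕ → Fin 2 → Strand
rightLabel m top    = m + 2
rightLabel m bottom = m + 1

Meet : (D : Filling m) (b b′ : Box m) → Set
Meet D b b′ = entries D b′ ≡ entries D b ⊎ swap (entries D b′) ≡ entries D b

meet? : (D : Filling m) (b b′ : Box m) → Dec (Meet D b b′)
meet? D b b′ =
  ≡-dec ℕ._≟_ ℕ._≟_ (entries D b′) (entries D b)
    ⊎-dec ≡-dec ℕ._≟_ ℕ._≟_ (swap (entries D b′)) (entries D b)

-- The number of times the two strands through the box b cross before b.  A
-- strand only travels right and down, so the boxes it visits before b are those
-- weakly northwest of b.  The box b itself is included in this range, but does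
-- not contribute when it is an elbow, the only case used below.
crossingsBefore : Filling m → Box m → ℕ
crossingsBefore D b@(c , r) = #Box λ b′ →
  (proj₁ b′ ≤? c) ×-dec (proj₂ b′ ≤? r) ×-dec (tile D b′ ≟ᵗ crossing) ×-dec meet? D b b′

elbows : Filling m → ℕ
elbows D = #Box λ b → tile D b ≟ᵗ elbow

-- For f₂,ₙ every strand exits at the edge carrying the same label as its
-- entrance.  The number of elbows is n − 1 = m + 1.
record IsMaxDeogram (D : Filling m) : Set where
  field
    bottom-exits  : ∀ c → bottomExit D c ≡ bottomLabel c
    right-exits   : ∀ r → rightExit D r ≡ rightLabel m r
    distinguished : ∀ b → tile D b ≡ elbow → 2 ∣ crossingsBefore D b
    maximal       : elbows D ≡ m + 1

ElbowColumn : Filling m → Fin m → Set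
ElbowColumn D c = ∀ r → tile D (c , r) ≡ elbow

-- The strands force every column to contain an elbow: in a column with two
-- crossings, the strand entering at the top would leave at the bottom.  As there
-- are m + 1 elbows in m columns, exactly one column contains two.
private
  entriesFrom-column : ∀ ls t (D : Filling m) c → ∃ λ ls′ →
    lookup (entriesFrom ls t D) c ≡ columnEntries (lookup D c) ls′ (toℕ c + t)
  entriesFrom-column ls t (Ts ∷ D) zero    = ls , refl
  entriesFrom-column ls t (Ts ∷ D) (suc c)
    with entriesFrom-column (columnRight Ts ls t) (suc t) D c
  ... | ls′ , eq = ls′ ,
    trans eq (cong (columnEntries (lookup D c) ls′) (+-suc (toℕ c) t))

  crossed-column : (Ts : Vec Tile 2) (ls : Vec Strand 2) (t : Strand) →
    lookup Ts top ≡ crossing → lookup Ts bottom ≡ crossing →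
    exitBottom (lookup Ts bottom) (lookup (columnEntries Ts ls t) bottom) ≡ t
  crossed-column (crossing ∷ crossing ∷ []) (_ ∷ _ ∷ []) t refl refl = refl

  no-crossed-column : (D : Filling m) → (∀ c → bottomExit D c ≡ bottomLabel c) →
    ∀ c → tile D (c , top) ≡ crossing → ¬ tile D (c , bottom) ≡ crossing
  no-crossed-column D exits c p q
    with entriesFrom-column leftLabels 3 D c | exits c
  ... | ls , eq | ex rewrite eq | crossed-column (lookup D c) ls (toℕ c + 3) p q =
    m+1+n≢m (toℕ c) (suc-injective (trans (sym (+-suc (toℕ c) 2)) ex))

  columnElbows : Filling m → Fin m → ℕ
  columnElbows D c = #Fin λ r → tile D (c , r) ≟ᵗ elbow

  columnElbows-pos : (D : Filling m) → (∀ c → bottomExit D c ≡ bottomLabel c) →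
    ∀ c → 1 ≤ columnElbows D c
  columnElbows-pos D exits c
    with tile D (c , top) | tile D (c , bottom) | no-crossed-column D exits c
  ... | crossing | crossing | bad = ⊥-elim (bad refl refl)
  ... | crossing | elbow    | _   = s≤s z≤n
  ... | elbow    | crossing | _   = s≤s z≤n
  ... | elbow    | elbow    | _   = s≤s z≤n

  two⇒elbowColumn : (D : Filling m) (c : Fin m) →
    1 < columnElbows D c → ElbowColumn D c
  two⇒elbowColumn D c 2≤ r
    with tile D (c , top) in p | tile D (c , bottom) in q
  two⇒elbowColumn D c (s≤s ()) r      | crossing | elbow
  two⇒elbowColumn D c (s≤s ()) r      | elbow    | crossing
  two⇒elbowColumn D c _        top    | elbow    | elbow = p
  two⇒elbowColumn D c _        bottom | elbow    | elbow = q

  elbowColumn⇒two : (D : Filling m) (c : Fin m) →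
    ElbowColumn D c → 1 < columnElbows D c
  elbowColumn⇒two D c both rewrite both top | both bottom = s≤s (s≤s z≤n)

  1≮1 : ¬ 1 < 1
  1≮1 (s≤s ())

  sum-≥ : (f : Fin m → ℕ) → (∀ c → 1 ≤ f c) → m ≤ sum (tabulate f)
  sum-≥ {zero}  f pos = z≤n
  sum-≥ {suc m} f pos = +-mono-≤ (pos zero) (sum-≥ (λ c → f (suc c)) λ c → pos (suc c))

  all-one : (f : Fin m → ℕ) → (∀ c → 1 ≤ f c) → sum (tabulate f) ≤ m →
    ∀ c → ¬ 1 < f c
  all-one {suc m} f pos s≤ c 1<fc with f zero in eq | pos zero
  all-one {suc m} f pos s≤ zero 1<fc | suc zero | _ = 1≮1 (subst (1 <_) eq 1<fc)
  all-one {suc m} f pos s≤ (suc c) 1<fc | suc zero | _ =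
    all-one (λ c → f (suc c)) (λ c → pos (suc c)) (≤-pred s≤) c 1<fc
  all-one {suc m} f pos s≤ c 1<fc | suc (suc k) | _ =
    1+n≰n (≤-trans (s≤s (sum-≥ (λ c → f (suc c)) λ c → pos (suc c)))
             (≤-trans (s≤s (m≤n+m _ k)) (≤-pred s≤)))

  unique-big : (f : Fin m → ℕ) → (∀ c → 1 ≤ f c) → sum (tabulate f) ≡ suc m →
    ∃! _≡_ λ c → 1 < f c
  unique-big {suc m} f pos eq with f zero in e | pos zero
  unique-big {suc m} f pos eq | suc zero | _
    with unique-big (λ c → f (suc c)) (λ c → pos (suc c)) (suc-injective eq)
  ... | c , big , uniq = suc c , big , λ {c′} → only c′
    where
    only : ∀ c′ → 1 < f c′ → suc c ≡ c′
    only zero    big′ = ⊥-elim (1≮1 (subst (1 <_) e big′))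
    only (suc _) big′ = cong suc (uniq big′)
  unique-big {suc m} f pos eq | suc (suc k) | _ =
    zero , subst (1 <_) (sym e) (s≤s (s≤s z≤n)) , λ {c′} → only c′
    where
    rest≤ : sum (tabulate λ c → f (suc c)) ≤ m
    rest≤ = ≤-trans (m≤n+m _ k) (≤-reflexive (suc-injective (suc-injective eq)))

    only : ∀ c′ → 1 < f c′ → zero ≡ c′
    only zero    _    = refl
    only (suc c) big′ =
      ⊥-elim (all-one (λ c → f (suc c)) (λ c → pos (suc c)) rest≤ c big′)

unique-elbowColumn : (D : Filling m) → IsMaxDeogram D → ∃! _≡_ (ElbowColumn D)
unique-elbowColumn {m} D isMax =
  let open IsMaxDeogram isMax
      c , big , uniq = unique-big (columnElbows D) (columnElbows-pos D bottom-exits)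
                         (trans maximal (+-comm m 1))
  in  c , two⇒elbowColumn D c big , λ both → uniq (elbowColumn⇒two D _ both)

record DeoMax (n : ℕ) : Set where
  field
    filling      : Filling (n ∸ 2)
    isMaxDeogram : IsMaxDeogram filling

  col : Fin (n ∸ 2)
  col = proj₁ (unique-elbowColumn filling isMaxDeogram)

  area : ℕ
  area = #Fin λ c → (col <? c) ×-dec (tile filling (c , top) ≟ᵗ elbow)

  dinv : ℕ
  dinv = #Fin λ c → (c <? col) ×-dec (tile filling (c , bottom) ≟ᵗ elbow)

-- The setoids on Deograms and paths only compare the underlying data, so that the
-- proofs of the defining conditions are irrelevant.
DeoMax-setoid : ℕ → Setoid 0ℓ 0ℓ
DeoMax-setoid n = On.setoid (setoid (Filling (n ∸ 2))) (DeoMax.filling {n})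

data Step : Set where
  up right : Step

#up #right : List Step → ℕ
#up []           = 0
#up (up    ∷ p)  = suc (#up p)
#up (right ∷ p)  = #up p
#right []          = 0
#right (up    ∷ p) = #right p
#right (right ∷ p) = suc (#right p)

-- The point (x , y) is not below the diagonal from (0 , 0) to (m , 2).
WeaklyAbove : (m x y : ℕ) → Set
WeaklyAbove m x y = 2 * x ≤ m * y

record IsDyck (m : ℕ) (p : List Step) : Set where
  field
    width  : #right p ≡ m
    height : #up p ≡ 2
    above  : ∀ q s → p ≡ q ++ s → WeaklyAbove m (#right q) (#up q)

-- The height at which the path passes over the i-th column, counting from 0.
heightAt : List Step → ℕ → ℕ
heightAt []          i       = 0
heightAt (up    ∷ p) i       = suc (heightAt p i)
heightAt (right ∷ p) zero    = 0
heightAt (right ∷ p) (suc i) = heightAt p i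

-- The box (i , j) is the unit square [i , i+1] × [j , j+1].
AbovePath BelowPath : List Step → Box m → Set
AbovePath p (i , j) = heightAt p (toℕ i) ≤ toℕ j
BelowPath p (i , j) = toℕ j < heightAt p (toℕ i)

abovePath? : (p : List Step) → Decidable (AbovePath {m} p)
abovePath? p (i , j) = heightAt p (toℕ i) ℕ.≤? toℕ j

belowPath? : (p : List Step) → Decidable (BelowPath {m} p)
belowPath? p (i , j) = toℕ j ℕ.<? heightAt p (toℕ i)

-- A full box lies above the diagonal when its southeast corner does.
AboveDiagonal : Box m → Set
AboveDiagonal {m} (i , j) = WeaklyAbove m (suc (toℕ i)) (toℕ j)

aboveDiagonal? : Decidable (AboveDiagonal {m})
aboveDiagonal? {m} (i , j) = 2 * suc (toℕ i) ℕ.≤? m * toℕ j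

arm leg : List Step → Box m → ℕ
arm {m} p (i , j) = #Fin λ (i′ : Fin m) → (i <? i′) ×-dec abovePath? p (i′ , j)
leg p (i , j) = #Fin λ j′ → (j′ <? j) ×-dec abovePath? p (i , j′)

-- arm / (leg + 1) < m / 2 < (arm + 1) / leg, with denominators cleared; the
-- second inequality then holds automatically when leg = 0.
DinvBox : List Step → Box m → Set
DinvBox {m} p b = 2 * arm p b < m * (leg p b + 1) × m * leg p b < 2 * (arm p b + 1)

dinvBox? : (p : List Step) → Decidable (DinvBox {m} p)
dinvBox? {m} p b =
  (2 * arm p b ℕ.<? m * (leg p b + 1)) ×-dec (m * leg p b ℕ.<? 2 * (arm p b + 1))

record Dyck₂ (n : ℕ) : Set where
  field
    path   : List Step
    isDyck : IsDyck (n ∸ 2) path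

  area : ℕ
  area = #Box {n ∸ 2} λ b → belowPath? path b ×-dec aboveDiagonal? b

  dinv : ℕ
  dinv = #Box {n ∸ 2} λ b → abovePath? path b ×-dec dinvBox? path b

Dyck₂-setoid : ℕ → Setoid 0ℓ 0ℓ
Dyck₂-setoid n = On.setoid (setoid (List Step)) (Dyck₂.path {n})

{-# OPTIONS --safe #-}
module Submission where

-- Between two columns of a Deogram the two strands in play carry consecutive labels,
-- in one of two orders.  Since the strand leaving at the bottom of each column is
-- prescribed, the order decides which columns may come next: EE or CE (crossing above
-- elbow) if the larger label is on top, and EC otherwise; CE and EC switch the order.
-- With only one elbow column, the Deograms are thus the words (CE EC)ˣ EE (CE EC)ʸ,
-- and all of them are distinguished, no two strands of an elbow crossing before it.
-- Here area = y and dinv = x, and rotation interchanges x and y.  The Dyck path of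
-- the word rises to height 1, passes over x columns, and rises to height 2.

open import Defs
open import Data.Bool using (true; false; if_then_else_)
open import Data.Empty using (⊥-elim)
open import Data.Fin using (Fin; zero; suc; toℕ)
import Data.Fin as Fin
open import Data.Fin.Properties using (toℕ-injective)
open import Data.List using (List; _++_; replicate)
import Data.List as List
open import Data.List.Properties using (∷-injectiveʳ)
open import Data.Nat using (ℕ; zero; suc; _+_; _*_; _∸_; _≤_; _<_; z≤n; s≤s; s≤s⁻¹; s<s⁻¹)
open import Data.Nat.Divisibility using (_∣_; ∣-refl; ∣m∣n⇒∣m+n; _∣0)
open import Data.Nat.Properties
open import Data.Product using (Σ-syntax; ∃; ∃₂; _×_; _,_; proj₁; proj₂; map₂; swap)
open import Data.Sum using (_⊎_; inj₁; inj₂)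
open import Data.Vec using (Vec; []; _∷_; _∷ʳ_; lookup; tabulate; allFin; count; map; reverse)
open import Data.Vec.Properties using (reverse-∷)
open import Function using (_∘_; id; _⇔_; mk⇔; Equivalence)
open import Function.Bundles using (Bijection)
open import Function.Properties.Inverse using (Inverse⇒Bijection)
open import Level using (0ℓ)
open import Relation.Binary.PropositionalEquality
  using (_≡_; refl; sym; trans; cong; cong₂; subst; module ≡-Reasoning)
open import Relation.Nullary using (¬_; does; contradiction)
open import Relation.Nullary.Decidable using (_×-dec_; dec-true; dec-false)
open import Relation.Unary using (Pred; Decidable)
open DeoMax using (filling)
open Bijection using (to)

private
  variable
    m k e x x′ y y′ : ℕ
    D : Filling m

-- Counting columns and boxes.

count-tabulate : ∀ {A : Set} {P : Pred A 0ℓ} (P? : Decidable P) (f : Fin k → A) →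
  count P? (tabulate f) ≡ #Fin (λ c → P? (f c))
count-tabulate {zero}  P? f = refl
count-tabulate {suc k} P? f = cong (if does (P? (f zero)) then suc else id)
  (trans (count-tabulate P? (f ∘ suc)) (sym (count-tabulate (P? ∘ f) suc)))

#Fin-suc : {P : Pred (Fin (suc k)) 0ℓ} (P? : Decidable P) →
  #Fin P? ≡ (if does (P? zero) then suc else id) (#Fin (P? ∘ suc))
#Fin-suc P? = cong (if does (P? zero) then suc else id) (count-tabulate P? suc)

-- Only the Boolean answers are compared, so that predicates about `suc c` and about `c` can be
-- matched without converting their proofs.
#Fin-cong : {P Q : Pred (Fin k) 0ℓ} (P? : Decidable P) (Q? : Decidable Q) →
  (∀ c → does (P? c) ≡ does (Q? c)) → #Fin P? ≡ #Fin Q?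
#Fin-cong {k} P? Q? eq = go (allFin k)
  where
  go : ∀ {n} (cs : Vec (Fin k) n) → count P? cs ≡ count Q? cs
  go []       = refl
  go (c ∷ cs) rewrite eq c | go cs = refl

#Fin-none : {P : Pred (Fin k) 0ℓ} (P? : Decidable P) → (∀ c → ¬ P c) → #Fin P? ≡ 0
#Fin-none {k} P? ¬p = go (allFin k)
  where
  go : ∀ {n} (cs : Vec (Fin k) n) → count P? cs ≡ 0
  go []       = refl
  go (c ∷ cs) rewrite dec-false (P? c) (¬p c) = go cs

#Box-none : {P : Pred (Box m) 0ℓ} (P? : Decidable P) → (∀ b → ¬ P b) → #Box P? ≡ 0
#Box-none {zero}  P? ¬p = refl
#Box-none {suc m} P? ¬p = cong₂ _+_
  (#Fin-none (λ r → P? (zero , r)) λ r → ¬p (zero , r))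
  (#Box-none (λ (c , r) → P? (suc c , r)) λ (c , r) → ¬p (suc c , r))

-- Neither Dyck statistic counts a box of the bottom row, so both reduce to counting columns.
#Box-row₁ : {P : Pred (Box m) 0ℓ} (P? : Decidable P) → (∀ c → ¬ P (c , zero)) →
  #Box P? ≡ #Fin (λ c → P? (c , suc zero))
#Box-row₁ {zero}  P? ¬p = refl
#Box-row₁ {suc m} P? ¬p
  rewrite dec-false (P? (zero , zero)) (¬p zero)
        | #Fin-suc (λ c → P? (c , suc zero))
        | #Box-row₁ (λ (c , r) → P? (suc c , r)) (¬p ∘ suc)
  with does (P? (zero , suc zero))
... | true  = refl
... | false = refl

-- Empty intervals are covered by truncated subtraction; they arise as arms of boxes in columns from
-- `x` on.
#Fin-interval : ∀ {P : Pred (Fin m) 0ℓ} (P? : Decidable P) a b → b ≤ m →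
  (∀ c → P c ⇔ (a ≤ toℕ c × toℕ c < b)) → #Fin P? ≡ b ∸ a
#Fin-interval P? a zero _ iff =
  trans (#Fin-none P? λ c p → n≮0 (proj₂ (Equivalence.to (iff c) p))) (sym (0∸n≡0 a))
#Fin-interval {suc m} P? zero (suc b) (s≤s b≤m) iff
  rewrite #Fin-suc P? | dec-true (P? zero) (Equivalence.from (iff zero) (z≤n , s≤s z≤n)) =
  cong suc (#Fin-interval (P? ∘ suc) zero b b≤m λ c → mk⇔
    (λ p → z≤n , s<s⁻¹ (proj₂ (Equivalence.to (iff (suc c)) p)))
    (λ (_ , c<b) → Equivalence.from (iff (suc c)) (z≤n , s≤s c<b)))
#Fin-interval {suc m} P? (suc a) (suc b) (s≤s b≤m) iff
  rewrite #Fin-suc P? | dec-false (P? zero) (λ p → n≮0 (proj₁ (Equivalence.to (iff zero) p))) =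
  #Fin-interval (P? ∘ suc) a b b≤m λ c → mk⇔
    (λ p → let a≤c , c<b = Equivalence.to (iff (suc c)) p in s≤s⁻¹ a≤c , s<s⁻¹ c<b)
    (λ (a≤c , c<b) → Equivalence.from (iff (suc c)) (s≤s a≤c , s≤s c<b))

pattern EE = elbow ∷ elbow ∷ []
pattern CE = crossing ∷ elbow ∷ []
pattern EC = elbow ∷ crossing ∷ []

-- Deograms as runs of an automaton

data Order : Set where
  straight swapped : Order

-- The strands on the i-th vertical line of a Deogram are i + 1 and i + 2.
strands : Order → ℕ → Vec Strand 2
strands straight i = 2 + i ∷ 1 + i ∷ []
strands swapped  i = 1 + i ∷ 2 + i ∷ []

-- Run o e D: the filling D, with e elbow columns, can be traversed starting from
-- strands in the order o, in such a way that each strand exits at its own label.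
data Run : Order → ℕ → Filling m → Set where
  []  : Run straight 0 []
  ee∷ : Run straight e D → Run straight (suc e) (EE ∷ D)
  ce∷ : Run swapped e D → Run straight e (CE ∷ D)
  ec∷ : Run straight e D → Run swapped e (EC ∷ D)

-- Induction on the columns. Admissible columns pass on strands of the same form with `i` raised by
-- one, so the offset `i` has to stay general.
exits⇒run : ∀ o i (D : Filling m) →
  (∀ c → exitBottom (tile D (c , bottom))
           (lookup (lookup (entriesFrom (strands o i) (3 + i) D) c) bottom) ≡ suc (toℕ c + i)) →
  rightFrom (strands o i) (3 + i) D ≡ strands straight (m + i) →
  ∃ λ e → Run o e D
exits⇒run {suc m} o i (T ∷ D) b r = step o T b r
  where
  continue : ∀ o o′ T → columnRight T (strands o i) (3 + i) ≡ strands o′ (suc i) →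
    (∀ c → exitBottom (tile (T ∷ D) (c , bottom))
           (lookup (lookup (entriesFrom (strands o i) (3 + i) (T ∷ D)) c) bottom) ≡ suc (toℕ c + i)) →
    rightFrom (strands o i) (3 + i) (T ∷ D) ≡ strands straight (suc m + i) →
    ∃ λ e → Run o′ e D
  continue o o′ T eq b r rewrite eq = exits⇒run o′ (suc i) D
    (λ c → trans (b (suc c)) (cong suc (sym (+-suc (toℕ c) i))))
    (trans r (cong (strands straight) (sym (+-suc m i))))

  step : ∀ o T →
    (∀ c → exitBottom (tile (T ∷ D) (c , bottom))
           (lookup (lookup (entriesFrom (strands o i) (3 + i) (T ∷ D)) c) bottom) ≡ suc (toℕ c + i)) →
    rightFrom (strands o i) (3 + i) (T ∷ D) ≡ strands straight (suc m + i) →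
    ∃ λ e → Run o e (T ∷ D)
  step straight EE b r = let e , run = continue straight straight EE refl b r in suc e , ee∷ run
  step straight CE b r = map₂ ce∷ (continue straight swapped CE refl b r)
  step swapped  EC b r = map₂ ec∷ (continue swapped straight EC refl b r)
  -- In the next three cases strand `2 + i` would leave at the bottom, where `1 + i` is prescribed.
  step straight EC b r = ⊥-elim (1+n≢n (b zero))
  step swapped  EE b r = ⊥-elim (1+n≢n (b zero))
  step swapped  CE b r = ⊥-elim (1+n≢n (b zero))
  -- Two crossings let the strand from above, `3 + i`, fall straight through.
  step straight (crossing ∷ crossing ∷ []) b r = ⊥-elim (m≢1+n+m _ {1} (sym (b zero)))
  step swapped  (crossing ∷ crossing ∷ []) b r = ⊥-elim (m≢1+n+m _ {1} (sym (b zero)))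
exits⇒run straight i [] b r = 0 , []
-- The right side has its larger label on top, whereas the swapped order has the smaller one there.
exits⇒run swapped  i [] b r = ⊥-elim (1+n≢n (sym (cong (λ v → lookup v top) r)))

-- Each column has one elbow, and each EE one more. Compared with the prescribed number, this forces
-- `e` to be 1.
run-elbows : ∀ {o} {D : Filling m} → Run o e D → elbows D ≡ e + m
run-elbows [] = refl
run-elbows {m = suc m} (ee∷ {e = e} run) =
  cong suc (trans (cong suc (run-elbows run)) (sym (+-suc e m)))
run-elbows {m = suc m} (ce∷ {e = e} run) = trans (cong suc (run-elbows run)) (sym (+-suc e m))
run-elbows {m = suc m} (ec∷ {e = e} run) = trans (cong suc (run-elbows run)) (sym (+-suc e m))

-- Entries, exits and crossings along a run.

data Column : Vec Tile 2 → Set where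
  ee : Column EE
  ce : Column CE
  ec : Column EC

run-column : ∀ {o} → Run o e D → ∀ c → Column (lookup D c)
run-column (ee∷ run) zero    = ee
run-column (ce∷ run) zero    = ce
run-column (ec∷ run) zero    = ec
run-column (ee∷ run) (suc c) = run-column run c
run-column (ce∷ run) (suc c) = run-column run c
run-column (ec∷ run) (suc c) = run-column run c

-- A crossing on top means CE, which leaves the order swapped, and then only EC can follow.
run-next : ∀ {o} {D : Filling m} → Run o e D → ∀ c c′ → toℕ c ≡ suc (toℕ c′) →
  tile D (c′ , top) ≡ crossing → tile D (c , bottom) ≡ crossing
run-next (ce∷ (ec∷ run)) (suc zero) zero     eq p = refl
run-next (ee∷ run)       (suc c)    (suc c′) eq p = run-next run c c′ (suc-injective eq) p
run-next (ce∷ run)       (suc c)    (suc c′) eq p = run-next run c c′ (suc-injective eq) p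
run-next (ec∷ run)       (suc c)    (suc c′) eq p = run-next run c c′ (suc-injective eq) p

-- In a run only EC is entered in the swapped order. The strands entering a column thus depend on
-- its tiles and its position alone.
entryOrder : Vec Tile 2 → Order
entryOrder EC = swapped
entryOrder _  = straight

runColumnEntries : ℕ → Vec Tile 2 → Vec (Strand × Strand) 2
runColumnEntries i T = columnEntries T (strands (entryOrder T) i) (3 + i)

run-entriesFrom : ∀ {o} {D : Filling m} → Run o e D → ∀ i c →
  lookup (entriesFrom (strands o i) (3 + i) D) c ≡ runColumnEntries (toℕ c + i) (lookup D c)
run-entriesFrom (ee∷ run) i zero = refl
run-entriesFrom (ce∷ run) i zero = refl
run-entriesFrom (ec∷ run) i zero = refl
run-entriesFrom {D = _ ∷ D} (ee∷ run) i (suc c) = trans (run-entriesFrom run (suc i) c)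
  (cong (λ j → runColumnEntries j (lookup D c)) (+-suc (toℕ c) i))
run-entriesFrom {D = _ ∷ D} (ce∷ run) i (suc c) = trans (run-entriesFrom run (suc i) c)
  (cong (λ j → runColumnEntries j (lookup D c)) (+-suc (toℕ c) i))
run-entriesFrom {D = _ ∷ D} (ec∷ run) i (suc c) = trans (run-entriesFrom run (suc i) c)
  (cong (λ j → runColumnEntries j (lookup D c)) (+-suc (toℕ c) i))

run-entries : {D : Filling m} → Run straight e D → ∀ c r →
  entries D (c , r) ≡ lookup (runColumnEntries (toℕ c) (lookup D c)) r
run-entries {D = D} run c r = cong (λ v → lookup v r) (trans (run-entriesFrom run 0 c)
  (cong (λ j → runColumnEntries j (lookup D c)) (+-identityʳ (toℕ c))))

run-rightFrom : ∀ {o} {D : Filling m} → Run o e D → ∀ i →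
  rightFrom (strands o i) (3 + i) D ≡ strands straight (m + i)
run-rightFrom [] i = refl
run-rightFrom {m = suc m} (ee∷ run) i =
  trans (run-rightFrom run (suc i)) (cong (strands straight) (+-suc m i))
run-rightFrom {m = suc m} (ce∷ run) i =
  trans (run-rightFrom run (suc i)) (cong (strands straight) (+-suc m i))
run-rightFrom {m = suc m} (ec∷ run) i =
  trans (run-rightFrom run (suc i)) (cong (strands straight) (+-suc m i))

run-bottomExit : {D : Filling m} → Run straight e D → ∀ c → bottomExit D c ≡ bottomLabel c
run-bottomExit {D = D} run c rewrite run-entries run c bottom with lookup D c | run-column run c
... | _ | ee = refl
... | _ | ce = refl
... | _ | ec = refl

run-rightExit : {D : Filling m} → Run straight e D → ∀ r → rightExit D r ≡ rightLabel m r
run-rightExit {m} run top    rewrite run-rightFrom run 0 | +-identityʳ m = +-comm 2 m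
run-rightExit {m} run bottom rewrite run-rightFrom run 0 | +-identityʳ m = +-comm 1 m

-- Strands crossing in column i carry adjacent labels, i + 2 and i + 3 or i + 1 and
-- i + 2, whereas those of the elbow in a column of type CE or EC are i + 1 and i + 3.
-- Only the elbows of EE columns could conflict with a crossing, and then only with
-- one of the same column or of a preceding CE.
no-earlier-crossing : ∀ {T T′} → Column T → Column T′ → ∀ i i′ r r′ →
  lookup T r ≡ elbow → lookup T′ r′ ≡ crossing → r′ Fin.≤ r →
  (i ≡ i′ → T ≡ T′) →
  (i ≡ suc i′ → lookup T′ top ≡ crossing → lookup T bottom ≡ crossing) →
  ¬ (lookup (runColumnEntries i′ T′) r′ ≡ lookup (runColumnEntries i T) r ⊎
     swap (lookup (runColumnEntries i′ T′) r′) ≡ lookup (runColumnEntries i T) r)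
no-earlier-crossing ce ce i i′ bottom top    _ _ _ _ _ (inj₁ ())
no-earlier-crossing ce ce i i′ bottom top    _ _ _ _ _ (inj₂ ())
no-earlier-crossing ce ec i i′ bottom bottom _ _ _ _ _ (inj₁ ())
no-earlier-crossing ce ec i i′ bottom bottom _ _ _ _ _ (inj₂ ())
no-earlier-crossing ec ce i i′ top    top    _ _ _ _ _ (inj₁ ())
no-earlier-crossing ec ce i i′ top    top    _ _ _ _ _ (inj₂ ())
no-earlier-crossing _  ce i i′ _      bottom _ () _ _ _ _
no-earlier-crossing ec ec i i′ top    bottom _ _ () _ _ _
no-earlier-crossing ec _  i i′ bottom _      () _ _ _ _ _
no-earlier-crossing _  ee i i′ _      top    _ () _ _ _ _
no-earlier-crossing _  ee i i′ _      bottom _ () _ _ _ _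
no-earlier-crossing ee ce i i′ top    top    _ _ _ same _ (inj₁ refl) = contradiction (same refl) λ ()
no-earlier-crossing ee ce i i′ top    top    _ _ _ _ _ (inj₂ ())
no-earlier-crossing ee ce i i′ bottom top    _ _ _ _ next (inj₁ refl) = contradiction (next refl refl) λ ()
no-earlier-crossing ee ce i i′ bottom top    _ _ _ _ _ (inj₂ ())
no-earlier-crossing ee ec i i′ bottom bottom _ _ _ _ _ (inj₁ ())
no-earlier-crossing ee ec i i′ bottom bottom _ _ _ same _ (inj₂ refl) = contradiction (same refl) λ ()

-- This is stronger than being distinguished, which asks only for an even number.
run-crossingsBefore : {D : Filling m} → Run straight e D → ∀ b → tile D b ≡ elbow →
  crossingsBefore D b ≡ 0
run-crossingsBefore {D = D} run b@(c , r) p = #Box-none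
  (λ b′ → (proj₁ b′ Fin.≤? c) ×-dec (proj₂ b′ Fin.≤? r) ×-dec
            (tile D b′ ≟ᵗ crossing) ×-dec meet? D b b′) none
  where
  none : ∀ b′ → ¬ (proj₁ b′ Fin.≤ c × proj₂ b′ Fin.≤ r × tile D b′ ≡ crossing × Meet D b b′)
  none (c′ , r′) (_ , r′≤r , q , meet)
    rewrite run-entries run c r | run-entries run c′ r′ =
    no-earlier-crossing (run-column run c) (run-column run c′) (toℕ c) (toℕ c′) r r′ p q r′≤r
      (cong (lookup D) ∘ toℕ-injective) (run-next run c c′) meet

run⇒isMaxDeogram : Run straight 1 D → IsMaxDeogram D
run⇒isMaxDeogram {m} {D} run = record
  { bottom-exits  = run-bottomExit run
  ; right-exits   = run-rightExit run
  ; distinguished = λ b p → subst (2 ∣_) (sym (run-crossingsBefore run b p)) (2 ∣0)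
  ; maximal       = trans (run-elbows run) (+-comm 1 m)
  }

isMaxDeogram⇒run : {D : Filling m} → IsMaxDeogram D → Run straight 1 D
isMaxDeogram⇒run {m} {D} isMax with exits⇒run straight 0 D
  (λ c → trans (bottom-exits c) (cong suc (sym (+-identityʳ (toℕ c)))))
  (rightStrands (rightFrom leftLabels 3 D) right-exits)
  where
  open IsMaxDeogram isMax
  rightStrands : ∀ v → (∀ r → lookup v r ≡ rightLabel m r) → v ≡ strands straight (m + 0)
  rightStrands (u ∷ v ∷ []) eq rewrite +-identityʳ m =
    cong₂ (λ a b → a ∷ b ∷ []) (trans (eq top) (+-comm m 2)) (trans (eq bottom) (+-comm m 1))
... | e , run
  -- The run has `e + m` elbows and a maximal Deogram has `m + 1`.
  with refl ← +-cancelʳ-≡ m e 1 (trans (sym (run-elbows run))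
                (trans (IsMaxDeogram.maximal isMax) (+-comm m 1))) = run

-- The words (CE EC)ˣ EE (CE EC)ʸ

data Pairs : ℕ → Filling m → Set where
  []   : Pairs 0 []
  pair : Pairs y D → Pairs (suc y) (CE ∷ EC ∷ D)

data Shape : ℕ → ℕ → Filling m → Set where
  here : Pairs y D → Shape 0 y (EE ∷ D)
  pair : Shape x y D → Shape (suc x) y (CE ∷ EC ∷ D)

-- After CE the run is in the swapped order, where it can neither end nor continue with anything but
-- EC.
run⇒pairs : Run straight 0 D → ∃ λ y → Pairs y D
run⇒pairs []              = 0 , []
run⇒pairs (ce∷ (ec∷ run)) = let y , ps = run⇒pairs run in suc y , pair ps

run⇒shape : Run straight 1 D → ∃₂ λ x y → Shape x y D
run⇒shape (ee∷ run)       = let y , ps = run⇒pairs run in 0 , y , here ps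
run⇒shape (ce∷ (ec∷ run)) = let x , y , sh = run⇒shape run in suc x , y , pair sh

pairs⇒run : Pairs y D → Run straight 0 D
pairs⇒run []        = []
pairs⇒run (pair ps) = ce∷ (ec∷ (pairs⇒run ps))

shape⇒run : Shape x y D → Run straight 1 D
shape⇒run (here ps) = ee∷ (pairs⇒run ps)
shape⇒run (pair sh) = ce∷ (ec∷ (shape⇒run sh))

deoShape : (D : Filling m) → IsMaxDeogram D → ∃₂ λ x y → Shape x y D
deoShape D isMax = run⇒shape (isMaxDeogram⇒run isMax)

pairs-width : {D : Filling m} → Pairs y D → m ≡ y * 2
pairs-width []        = refl
pairs-width (pair ps) = cong (2 +_) (pairs-width ps)

shape-width : {D : Filling m} → Shape x y D → m ≡ suc ((x + y) * 2)
shape-width (here ps) = cong suc (pairs-width ps)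
shape-width (pair sh) = cong (2 +_) (shape-width sh)

pairs-exists : ∀ y → ∃ λ (D : Filling (y * 2)) → Pairs y D
pairs-exists zero    = [] , []
pairs-exists (suc y) = let D , ps = pairs-exists y in CE ∷ EC ∷ D , pair ps

shape-exists : ∀ x y → ∃ λ (D : Filling (suc ((x + y) * 2))) → Shape x y D
shape-exists zero    y = let D , ps = pairs-exists y in EE ∷ D , here ps
shape-exists (suc x) y = let D , sh = shape-exists x y in CE ∷ EC ∷ D , pair sh

pairs-unique : {D D′ : Filling m} → Pairs y D → Pairs y′ D′ → D ≡ D′
pairs-unique []        []         = refl
pairs-unique (pair ps) (pair ps′) = cong (λ D → CE ∷ EC ∷ D) (pairs-unique ps ps′)

-- The second indices may differ a priori: the common width and `x` already determine the word.
shape-unique : {D D′ : Filling m} → Shape x y D → Shape x y′ D′ → D ≡ D′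
shape-unique (here ps) (here ps′) = cong (EE ∷_) (pairs-unique ps ps′)
shape-unique (pair sh) (pair sh′) = cong (λ D → CE ∷ EC ∷ D) (shape-unique sh sh′)

-- Both shapes locate the same EE. This relates the `x` extracted from a Deogram's proof to one
-- known otherwise.
shape-functional : Shape x y D → Shape x′ y′ D → x ≡ x′
shape-functional (here _)  (here _)   = refl
shape-functional (pair sh) (pair sh′) = cong suc (shape-functional sh sh′)

-- The statistics of a Deogram.

pairs-¬elbowColumn : Pairs y D → ∀ c → ¬ ElbowColumn D c
pairs-¬elbowColumn (pair ps) zero          both = contradiction (both top) λ ()
pairs-¬elbowColumn (pair ps) (suc zero)    both = contradiction (both bottom) λ ()
pairs-¬elbowColumn (pair ps) (suc (suc c)) both = pairs-¬elbowColumn ps c both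

pairs-topElbows : {D : Filling m} → Pairs y D → #Fin (λ c → tile D (c , top) ≟ᵗ elbow) ≡ y
pairs-topElbows [] = refl
pairs-topElbows (pair {D = D} ps)
  rewrite #Fin-suc (λ c → tile (CE ∷ EC ∷ D) (c , top) ≟ᵗ elbow)
        | #Fin-suc (λ c → tile (EC ∷ D) (c , top) ≟ᵗ elbow) = cong suc (pairs-topElbows ps)

-- The predicates of `DeoMax.area` and `DeoMax.dinv` are restated with a free `col`, which can then
-- shift in an induction.
area? : (D : Filling m) (col : Fin m) →
  Decidable (λ c → col Fin.< c × tile D (c , top) ≡ elbow)
area? D col c = (col Fin.<? c) ×-dec (tile D (c , top) ≟ᵗ elbow)

dinv? : (D : Filling m) (col : Fin m) →
  Decidable (λ c → c Fin.< col × tile D (c , bottom) ≡ elbow)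
dinv? D col c = (c Fin.<? col) ×-dec (tile D (c , bottom) ≟ᵗ elbow)

-- Each pair CE EC to the right of EE contributes the top elbow of its EC. The column is any elbow
-- column, because `DeoMax.col` comes out of a uniqueness proof and is known only by that property.
shape-area : {D : Filling m} → Shape x y D → ∀ {col} → ElbowColumn D col → #Fin (area? D col) ≡ y
shape-area (here {D = D} ps) {zero} both = begin
  #Fin (area? (EE ∷ D) zero)                ≡⟨ #Fin-suc (area? (EE ∷ D) zero) ⟩
  #Fin (area? (EE ∷ D) zero ∘ suc)          ≡⟨ #Fin-cong (area? (EE ∷ D) zero ∘ suc) _ (λ _ → refl) ⟩
  #Fin (λ c → tile D (c , top) ≟ᵗ elbow)    ≡⟨ pairs-topElbows ps ⟩
  _                                         ∎
  where open ≡-Reasoning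
shape-area (here ps) {suc col} both = contradiction both (pairs-¬elbowColumn ps col)
shape-area (pair sh) {zero}     both = contradiction (both top) λ ()
shape-area (pair sh) {suc zero} both = contradiction (both bottom) λ ()
shape-area (pair {D = D} sh) {suc (suc col)} both = begin
  #Fin P?                  ≡⟨ #Fin-suc P? ⟩
  #Fin (P? ∘ suc)          ≡⟨ #Fin-suc (P? ∘ suc) ⟩
  #Fin P″?                 ≡⟨ #Fin-cong P″? (area? D col) (λ _ → refl) ⟩
  #Fin (area? D col)       ≡⟨ shape-area sh both ⟩
  _                        ∎
  where
  open ≡-Reasoning
  P? = area? (CE ∷ EC ∷ D) (suc (suc col))
  P″? = λ c → P? (suc (suc c))

-- Each pair to the left of EE contributes the bottom elbow of its CE.
shape-dinv : {D : Filling m} → Shape x y D → ∀ {col} → ElbowColumn D col → #Fin (dinv? D col) ≡ x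
shape-dinv (here {D = D} ps) {zero} both = #Fin-none (dinv? (EE ∷ D) zero) λ c p → n≮0 (proj₁ p)
shape-dinv (here ps) {suc col} both = contradiction both (pairs-¬elbowColumn ps col)
shape-dinv (pair sh) {zero}     both = contradiction (both top) λ ()
shape-dinv (pair sh) {suc zero} both = contradiction (both bottom) λ ()
shape-dinv (pair {D = D} sh) {suc (suc col)} both = begin
  #Fin P?                      ≡⟨ #Fin-suc P? ⟩
  suc (#Fin (P? ∘ suc))        ≡⟨ cong suc (#Fin-suc (P? ∘ suc)) ⟩
  suc (#Fin P″?)               ≡⟨ cong suc (#Fin-cong P″? (dinv? D col) (λ _ → refl)) ⟩
  suc (#Fin (dinv? D col))     ≡⟨ cong suc (shape-dinv sh both) ⟩
  _                            ∎
  where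
  open ≡-Reasoning
  P? = dinv? (CE ∷ EC ∷ D) (suc (suc col))
  P″? = λ c → P? (suc (suc c))

module _ {n} (D : DeoMax n) (sh : Shape x y (filling D)) where
  private
    elbow-col : ElbowColumn (filling D) (DeoMax.col D)
    elbow-col = proj₁ (proj₂ (unique-elbowColumn (filling D) (DeoMax.isMaxDeogram D)))

  deo-area : DeoMax.area D ≡ y
  deo-area = shape-area sh elbow-col

  deo-dinv : DeoMax.dinv D ≡ x
  deo-dinv = shape-dinv sh elbow-col

-- Rotation

-- Rotation moves leading pairs to the end, whereas `Pairs` and `Shape` are built from the front.
pairs-∷ʳ : Pairs y D → Pairs (suc y) (D ∷ʳ CE ∷ʳ EC)
pairs-∷ʳ []        = pair []
pairs-∷ʳ (pair ps) = pair (pairs-∷ʳ ps)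

shape-∷ʳ : Shape x y D → Shape x (suc y) (D ∷ʳ CE ∷ʳ EC)
shape-∷ʳ (here ps) = here (pairs-∷ʳ ps)
shape-∷ʳ (pair sh) = pair (shape-∷ʳ sh)

pairs-∷ʳ-EE : Pairs y D → Shape y 0 (D ∷ʳ EE)
pairs-∷ʳ-EE []        = here []
pairs-∷ʳ-EE (pair ps) = pair (pairs-∷ʳ-EE ps)

rotate180-∷ : ∀ T (D : Filling m) → rotate180 (T ∷ D) ≡ rotate180 D ∷ʳ reverse T
rotate180-∷ T D = reverse-∷ (reverse T) (map reverse D)

-- Rotation exchanges CE and EC and also reverses their order, so a pair stays a pair.
rotate180-pair : (D : Filling m) → rotate180 (CE ∷ EC ∷ D) ≡ rotate180 D ∷ʳ CE ∷ʳ EC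
rotate180-pair D = trans (rotate180-∷ CE (EC ∷ D)) (cong (_∷ʳ EC) (rotate180-∷ EC D))

pairs-rotate : Pairs y D → Pairs y (rotate180 D)
pairs-rotate []                = []
pairs-rotate (pair {D = D} ps) = subst (Pairs _) (sym (rotate180-pair D)) (pairs-∷ʳ (pairs-rotate ps))

shape-rotate : Shape x y D → Shape y x (rotate180 D)
shape-rotate (here {D = D} ps) =
  subst (Shape _ _) (sym (rotate180-∷ EE D)) (pairs-∷ʳ-EE (pairs-rotate ps))
shape-rotate (pair {D = D} sh) =
  subst (Shape _ _) (sym (rotate180-pair D)) (shape-∷ʳ (shape-rotate sh))

-- Membership follows from the rotated shape; the strands of the rotated filling need not be traced.
rotateDeo : ∀ {n} → DeoMax n → DeoMax n
rotateDeo D = record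
  { filling      = rotate180 (filling D)
  ; isMaxDeogram = let _ , _ , sh = deoShape (filling D) (DeoMax.isMaxDeogram D)
                   in  run⇒isMaxDeogram (shape⇒run (shape-rotate sh))
  }

-- Exchanging `x` and `y` twice restores the shape, and the shape determines the filling.
rotate180-involutive : {D : Filling m} → Shape x y D → rotate180 (rotate180 D) ≡ D
rotate180-involutive sh = shape-unique (shape-rotate (shape-rotate sh)) sh

rotation : ∀ n → Bijection (DeoMax-setoid n) (DeoMax-setoid n)
rotation n = Inverse⇒Bijection record
  { to        = rotateDeo
  ; from      = rotateDeo
  ; to-cong   = cong rotate180
  ; from-cong = cong rotate180
  ; inverse   = (λ {D} {E} → inv D {E}) , (λ {D} {E} → inv D {E})
  }
  where
  inv : (D : DeoMax n) {E : DeoMax n} → filling E ≡ rotate180 (filling D) →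
    rotate180 (filling E) ≡ filling D
  inv D eq = let _ , _ , sh = deoShape (filling D) (DeoMax.isMaxDeogram D)
             in  trans (cong rotate180 eq) (rotate180-involutive sh)

rotation-stats : ∀ {n} (D : DeoMax n) →
  (DeoMax.area D , DeoMax.dinv D) ≡ (DeoMax.dinv (rotateDeo D) , DeoMax.area (rotateDeo D))
rotation-stats D = cong₂ _,_
  (trans (deo-area D sh) (sym (deo-dinv (rotateDeo D) (shape-rotate sh))))
  (trans (deo-dinv D sh) (sym (deo-area (rotateDeo D) (shape-rotate sh))))
  where sh = proj₂ (proj₂ (deoShape (filling D) (DeoMax.isMaxDeogram D)))

-- Dyck paths

-- The path in a rectangle of width m that passes over x columns at height 1.
dyckPath : ℕ → ℕ → List Step
dyckPath m x = up List.∷ replicate x right ++ up List.∷ replicate (m ∸ x) right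

#up-rights : ∀ x q → #up (replicate x right ++ q) ≡ #up q
#up-rights zero    q = refl
#up-rights (suc x) q = #up-rights x q

#right-rights : ∀ x q → #right (replicate x right ++ q) ≡ x + #right q
#right-rights zero    q = refl
#right-rights (suc x) q = cong suc (#right-rights x q)

#up-replicate : ∀ x → #up (replicate x right) ≡ 0
#up-replicate zero    = refl
#up-replicate (suc x) = #up-replicate x

#right-replicate : ∀ x → #right (replicate x right) ≡ x
#right-replicate zero    = refl
#right-replicate (suc x) = cong suc (#right-replicate x)

#right-prefix : ∀ q s → #right q ≤ #right (q ++ s)
#right-prefix List.[]          s = z≤n
#right-prefix (up    List.∷ q) s = #right-prefix q s
#right-prefix (right List.∷ q) s = s≤s (#right-prefix q s)

-- A prefix either stops before the second up step of the path or contains it; these are the two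
-- cases of the diagonal condition.
rights-prefix : ∀ x p q s → replicate x right ++ up List.∷ p ≡ q ++ s → #right q ≤ x ⊎ 1 ≤ #up q
rights-prefix x       p List.[]          s eq = inj₁ z≤n
rights-prefix x       p (up    List.∷ q) s eq = inj₂ (s≤s z≤n)
rights-prefix zero    p (right List.∷ q) s ()
rights-prefix (suc x) p (right List.∷ q) s eq with rights-prefix x p q s (∷-injectiveʳ eq)
... | inj₁ q≤x = inj₁ (s≤s q≤x)
... | inj₂ 1≤q = inj₂ 1≤q

rights-injective : ∀ x x′ {p p′} →
  replicate x right ++ up List.∷ p ≡ replicate x′ right ++ up List.∷ p′ → x ≡ x′
rights-injective zero    zero     eq = refl
rights-injective (suc x) (suc x′) eq = cong suc (rights-injective x x′ (∷-injectiveʳ eq))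

no-ups : ∀ p → #up p ≡ 0 → p ≡ replicate (#right p) right
no-ups List.[]          eq = refl
no-ups (right List.∷ p) eq = cong (right List.∷_) (no-ups p eq)

one-up : ∀ p → #up p ≡ 1 → ∃₂ λ x z → p ≡ replicate x right ++ up List.∷ replicate z right
one-up (up    List.∷ p) eq = 0 , #right p , cong (up List.∷_) (no-ups p (suc-injective eq))
one-up (right List.∷ p) eq =
  let x , z , eq′ = one-up p eq in suc x , z , cong (right List.∷_) eq′

-- At height 1 the critical point is the corner (x , 1), where the hypothesis is the diagonal
-- condition; at height 2 the total width suffices.
dyckPath-isDyck : 2 * x ≤ m → IsDyck m (dyckPath m x)
dyckPath-isDyck {x} {m} 2x≤m = record
  { width  = width
  ; height = cong suc (trans (#up-rights x _) (cong suc (#up-replicate (m ∸ x))))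
  ; above  = above
  }
  where
  open ≤-Reasoning

  width : #right (dyckPath m x) ≡ m
  width = trans (#right-rights x _) (trans (cong (x +_) (#right-replicate (m ∸ x)))
            (m+[n∸m]≡n (≤-trans (m≤m+n x _) 2x≤m)))

  above : ∀ q s → dyckPath m x ≡ q ++ s → WeaklyAbove m (#right q) (#up q)
  above List.[]          s eq = z≤n
  above (up List.∷ q) s eq with rights-prefix x _ q s (∷-injectiveʳ eq)
  ... | inj₁ q≤x = begin
    2 * #right q        ≤⟨ *-monoʳ-≤ 2 q≤x ⟩
    2 * x               ≤⟨ 2x≤m ⟩
    m                   ≡⟨ *-identityʳ m ⟨
    m * 1               ≤⟨ *-monoʳ-≤ m (s≤s z≤n) ⟩
    m * suc (#up q)     ∎
  ... | inj₂ 1≤q = begin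
    2 * #right q            ≤⟨ *-monoʳ-≤ 2 (#right-prefix q s) ⟩
    2 * #right (q ++ s)     ≡⟨ cong (λ p → 2 * #right p) eq ⟨
    2 * #right (dyckPath m x) ≡⟨ cong (2 *_) width ⟩
    2 * m                   ≡⟨ *-comm 2 m ⟩
    m * 2                   ≤⟨ *-monoʳ-≤ m (s≤s 1≤q) ⟩
    m * suc (#up q)         ∎

isDyck⇒dyckPath : ∀ p → IsDyck m p → ∃ λ x → 2 * x ≤ m × p ≡ dyckPath m x
isDyck⇒dyckPath List.[] isDyck = contradiction (IsDyck.height isDyck) λ ()
-- A first step to the right would reach (1 , 0), below the diagonal.
isDyck⇒dyckPath {m} (right List.∷ p) isDyck =
  contradiction (subst (2 ≤_) (*-zeroʳ m) (IsDyck.above isDyck (right List.∷ List.[]) p refl)) n≮0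
isDyck⇒dyckPath {m} (up List.∷ p) isDyck with one-up p (suc-injective (IsDyck.height isDyck))
... | x , z , refl = x , 2x≤m , cong (λ z → up List.∷ replicate x right ++ up List.∷ replicate z right) z≡
  where
  2x≤m : 2 * x ≤ m
  -- The diagonal condition is applied just before the second up step, at (x , 1).
  2x≤m with 2r≤ ← IsDyck.above isDyck (up List.∷ replicate x right) _ refl
    rewrite #right-replicate x | #up-replicate x | *-identityʳ m = 2r≤

  z≡ : z ≡ m ∸ x
  z≡ = begin
    z                                            ≡⟨ m+n∸m≡n x z ⟨
    x + z ∸ x                                    ≡⟨ cong (λ w → x + w ∸ x) (#right-replicate z) ⟨
    x + #right (replicate z right) ∸ x           ≡⟨ cong (_∸ x) (#right-rights x _) ⟨
    #right (replicate x right ++ up List.∷ replicate z right) ∸ x ≡⟨ cong (_∸ x) (IsDyck.width isDyck) ⟩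
    m ∸ x                                        ∎
    where open ≡-Reasoning

-- Heights and statistics of the Dyck paths.

heightAt-rights : ∀ x q i → i < x → heightAt (replicate x right ++ q) i ≡ 0
heightAt-rights (suc x) q zero    _         = refl
heightAt-rights (suc x) q (suc i) (s≤s i<x) = heightAt-rights x q i i<x

heightAt-replicate : ∀ z i → heightAt (replicate z right) i ≡ 0
heightAt-replicate zero    i       = refl
heightAt-replicate (suc z) zero    = refl
heightAt-replicate (suc z) (suc i) = heightAt-replicate z i

heightAt-rights-up : ∀ x z i → x ≤ i →
  heightAt (replicate x right ++ up List.∷ replicate z right) i ≡ 1
heightAt-rights-up zero    z i       _         = cong suc (heightAt-replicate z i)
heightAt-rights-up (suc x) z (suc i) (s≤s x≤i) = heightAt-rights-up x z i x≤i

heightAt-dyckPath-< : ∀ {i} → i < x → heightAt (dyckPath m x) i ≡ 1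
heightAt-dyckPath-< {x} {i = i} i<x = cong suc (heightAt-rights x _ i i<x)

heightAt-dyckPath-≥ : ∀ {i} → x ≤ i → heightAt (dyckPath m x) i ≡ 2
heightAt-dyckPath-≥ {x} {m} {i} x≤i = cong suc (heightAt-rights-up x (m ∸ x) i x≤i)

belowPath⇔ : (c : Fin k) → BelowPath (dyckPath m x) (c , suc zero) ⇔ x ≤ toℕ c
belowPath⇔ {m = m} {x = x} c = mk⇔
  (λ below → ≮⇒≥ λ c<x → 1+n≰n (subst (2 ≤_) (heightAt-dyckPath-< {m = m} c<x) below))
  (λ x≤c → ≤-reflexive (sym (heightAt-dyckPath-≥ {m = m} x≤c)))

abovePath⇔ : (c : Fin k) → AbovePath (dyckPath m x) (c , suc zero) ⇔ toℕ c < x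
abovePath⇔ {m = m} {x = x} c = mk⇔
  (λ above → ≰⇒> λ x≤c → 1+n≰n (subst (_≤ 1) (heightAt-dyckPath-≥ {m = m} x≤c) above))
  (λ c<x → ≤-reflexive (heightAt-dyckPath-< {m = m} c<x))

-- As the width `suc (k * 2)` is odd, its half can be rounded down to `k` in the diagonal condition.
2*≤suc[*2]⇒≤ : ∀ a k → 2 * a ≤ suc (k * 2) → a ≤ k
2*≤suc[*2]⇒≤ a k rewrite *-comm 2 a = go a k
  where
  go : ∀ a k → a * 2 ≤ suc (k * 2) → a ≤ k
  go zero    k       _            = z≤n
  go (suc a) zero    (s≤s ())
  go (suc a) (suc k) (s≤s (s≤s p)) = s≤s (go a k p)

≤⇒2*≤suc[*2] : ∀ {a k} → a ≤ k → 2 * a ≤ suc (k * 2)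
≤⇒2*≤suc[*2] {a} {k} a≤k rewrite *-comm 2 a = m≤n⇒m≤1+n (*-monoˡ-≤ 2 a≤k)

-- In the top row the boxes below the path start at column `x`, and those above the diagonal end
-- before column `k`.
dyckPath-area : ∀ k x →
  #Box {suc (k * 2)} (λ b → belowPath? (dyckPath (suc (k * 2)) x) b ×-dec aboveDiagonal? b) ≡ k ∸ x
dyckPath-area k x = trans
  (#Box-row₁ P? λ c (_ , diagonal) → n≮0 (subst (2 * suc (toℕ c) ≤_) (*-zeroʳ (k * 2)) diagonal))
  (#Fin-interval (λ c → P? (c , suc zero)) x k (m≤n⇒m≤1+n (m≤m*n k 2)) λ c → mk⇔
    (λ (below , diagonal) → Equivalence.to (belowPath⇔ c) below ,
      2*≤suc[*2]⇒≤ (suc (toℕ c)) k (subst (2 * suc (toℕ c) ≤_) (*-identityʳ _) diagonal))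
    (λ (x≤c , c<k) → Equivalence.from (belowPath⇔ c) x≤c ,
      subst (2 * suc (toℕ c) ≤_) (sym (*-identityʳ _)) (≤⇒2*≤suc[*2] c<k)))
  where
  P? : Decidable {A = Box (suc (k * 2))} λ b → BelowPath (dyckPath (suc (k * 2)) x) b × AboveDiagonal b
  P? b = belowPath? (dyckPath (suc (k * 2)) x) b ×-dec aboveDiagonal? b

-- Since 2x is at most the odd number m, an arm, having fewer than x boxes, satisfies
-- arm < m / 2.
dyckPath-dinvBox : ∀ k x → x ≤ k → (c : Fin (suc (k * 2))) →
  DinvBox (dyckPath (suc (k * 2)) x) (c , suc zero)
dyckPath-dinvBox k x x≤k c = arm< , subst (_< 2 * (arm p b + 1)) (sym (trans (cong (w *_) leg≡0) (*-zeroʳ w)))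
    (≤-trans (s≤s z≤n) (*-monoʳ-≤ 2 (m≤n+m 1 (arm p b))))
  where
  w : ℕ
  w = suc (k * 2)
  p = dyckPath w x
  b : Box w
  b = c , suc zero

  arm≤ : arm p b ≤ x
  arm≤ = ≤-trans (≤-reflexive (#Fin-interval (λ c′ → (c Fin.<? c′) ×-dec abovePath? p (c′ , suc zero))
      (suc (toℕ c)) x (m≤n⇒m≤1+n (≤-trans x≤k (m≤m*n k 2))) λ c′ → mk⇔
        (λ (c<c′ , above) → c<c′ , Equivalence.to (abovePath⇔ {m = w} {x = x} c′) above)
        (λ (c<c′ , c′<x) → c<c′ , Equivalence.from (abovePath⇔ {m = w} {x = x} c′) c′<x)))
    (m∸n≤m x (suc (toℕ c)))

  leg≡0 : leg p b ≡ 0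
  leg≡0 = #Fin-none (λ j → (j Fin.<? proj₂ b) ×-dec abovePath? p (c , j)) none
    where
    none : ∀ j → ¬ (j Fin.< proj₂ b × AbovePath p (c , j))
    -- The path starts with an up step, so the whole bottom row lies below it.
    none zero       (_ , ())
    none (suc zero) (s≤s () , _)

  arm< : 2 * arm p b < w * (leg p b + 1)
  arm< = begin-strict
    2 * arm p b          ≤⟨ *-monoʳ-≤ 2 (≤-trans arm≤ x≤k) ⟩
    2 * k                ≡⟨ *-comm 2 k ⟩
    k * 2                <⟨ n<1+n _ ⟩
    w                    ≡⟨ *-identityʳ w ⟨
    w * 1                ≤⟨ *-monoʳ-≤ w (m≤n+m 1 (leg p b)) ⟩
    w * (leg p b + 1)    ∎
    where open ≤-Reasoning

-- Every box above the path satisfies the arm and leg condition, and these boxes are the first `x`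
-- of the top row.
dyckPath-dinv : ∀ k x → x ≤ k →
  #Box {suc (k * 2)} (λ b → abovePath? (dyckPath (suc (k * 2)) x) b ×-dec
                            dinvBox? (dyckPath (suc (k * 2)) x) b) ≡ x
dyckPath-dinv k x x≤k = trans
  (#Box-row₁ P? λ where _ (() , _))
  (#Fin-interval (λ c → P? (c , suc zero)) 0 x (m≤n⇒m≤1+n (≤-trans x≤k (m≤m*n k 2))) λ c → mk⇔
    (λ (above , _) → z≤n , Equivalence.to (abovePath⇔ c) above)
    (λ (_ , c<x) → Equivalence.from (abovePath⇔ c) c<x , dyckPath-dinvBox k x x≤k c))
  where
  p = dyckPath (suc (k * 2)) x
  P? : Decidable {A = Box (suc (k * 2))} λ b → AbovePath p b × DinvBox p b
  P? b = abovePath? p b ×-dec dinvBox? p b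

-- The bijection

module _ (k : ℕ) where
  private
    w : ℕ
    w = suc (k * 2)

    shapeOf : (D : DeoMax (2 + w)) → ∃₂ λ x y → Shape x y (filling D)
    shapeOf D = deoShape (filling D) (DeoMax.isMaxDeogram D)

    -- Here `k` is the total number of pairs, so `x` is at most `k`, the same bound that the
    -- diagonal imposes on paths.
    size : {D : Filling w} → Shape x y D → k ≡ x + y
    size sh = *-cancelʳ-≡ k _ 2 (suc-injective (shape-width sh))

    size-≤ : {D : Filling w} → Shape x y D → x ≤ k
    size-≤ {x} {y} sh = subst (x ≤_) (sym (size sh)) (m≤m+n x y)

    toDyck : DeoMax (2 + w) → Dyck₂ (2 + w)
    toDyck D = let x , _ , sh = shapeOf D in record
      { path   = dyckPath w x
      ; isDyck = dyckPath-isDyck (≤⇒2*≤suc[*2] (size-≤ sh))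
      }

    ofShape : (D : Filling w) → Shape x y D → DeoMax (2 + w)
    ofShape D sh = record { filling = D ; isMaxDeogram = run⇒isMaxDeogram (shape⇒run sh) }

    -- The path is defined through an `x` extracted from the proof part of `D`; any known shape may
    -- be used in its place.
    toDyck-shape : (D : DeoMax (2 + w)) → Shape x y (filling D) → Dyck₂.path (toDyck D) ≡ dyckPath w x
    toDyck-shape D sh = cong (dyckPath w) (shape-functional (proj₂ (proj₂ (shapeOf D))) sh)

    toDyck-cong : (D D′ : DeoMax (2 + w)) → filling D ≡ filling D′ →
      Dyck₂.path (toDyck D) ≡ Dyck₂.path (toDyck D′)
    toDyck-cong D D′ eq = let _ , _ , sh′ = shapeOf D′ in
      toDyck-shape D (subst (Shape _ _) (sym eq) sh′)

    toDyck-injective : (D D′ : DeoMax (2 + w)) → Dyck₂.path (toDyck D) ≡ Dyck₂.path (toDyck D′) →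
      filling D ≡ filling D′
    toDyck-injective D D′ eq with x , _ , sh ← shapeOf D | x′ , _ , sh′ ← shapeOf D′
      -- The right steps between the two up steps recover `x`, and `x` determines the filling.
      with refl ← rights-injective x x′ (∷-injectiveʳ eq) = shape-unique sh sh′

    toDyck-surjective : (P : Dyck₂ (2 + w)) → ∃ λ D → Dyck₂.path (toDyck D) ≡ Dyck₂.path P
    toDyck-surjective P
      with x , 2x≤w , eq ← isDyck⇒dyckPath (Dyck₂.path P) (Dyck₂.isDyck P)
      -- Replacing `k` by `x + y` makes the word of shape `x`, `y` have width `w` definitionally.
      with y , refl ← m≤n⇒∃[o]m+o≡n (2*≤suc[*2]⇒≤ x k 2x≤w)
      = let D , sh = shape-exists x y in
        ofShape D sh , trans (toDyck-shape (ofShape D sh) sh) (sym eq)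

  deoToDyck : Bijection (DeoMax-setoid (2 + w)) (Dyck₂-setoid (2 + w))
  deoToDyck = record
    { to        = toDyck
    ; cong      = λ {D} {D′} → toDyck-cong D D′
    ; bijective = (λ {D} {D′} → toDyck-injective D D′) , λ P →
        let D , eq = toDyck-surjective P
        in  D , λ {D′} D′≡D → trans (toDyck-cong D′ D D′≡D) eq
    }

  deoToDyck-area : (D : DeoMax (2 + w)) → Dyck₂.area (to deoToDyck D) ≡ DeoMax.area D
  deoToDyck-area D = let x , y , sh = shapeOf D in begin
    Dyck₂.area (toDyck D)  ≡⟨ dyckPath-area k x ⟩
    k ∸ x                  ≡⟨ cong (_∸ x) (size sh) ⟩
    x + y ∸ x              ≡⟨ m+n∸m≡n x y ⟩
    y                      ≡⟨ deo-area D sh ⟨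
    DeoMax.area D          ∎
    where open ≡-Reasoning

  deoToDyck-dinv : (D : DeoMax (2 + w)) → Dyck₂.dinv (to deoToDyck D) ≡ DeoMax.dinv D
  deoToDyck-dinv D = let x , _ , sh = shapeOf D in
    trans (dyckPath-dinv k x (size-≤ sh)) (sym (deo-dinv D sh))

odd : ∀ m → ¬ 2 ∣ m → ∃ λ k → m ≡ suc (k * 2)
odd zero          ¬2∣ = contradiction (2 ∣0) ¬2∣
odd (suc zero)    ¬2∣ = 0 , refl
odd (suc (suc m)) ¬2∣ =
  let k , eq = odd m (¬2∣ ∘ ∣m∣n⇒∣m+n ∣-refl) in suc k , cong (2 +_) eq

theorem7p7 : (n : ℕ) → 3 ≤ n → ¬ (2 ∣ n) →
    (Σ[ Φ ∈ Bijection (DeoMax-setoid n) (Dyck₂-setoid n) ]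
    (∀ (D : DeoMax n) → (Dyck₂.area (to Φ D) ≡ DeoMax.area D) × (Dyck₂.dinv (to Φ D) ≡ DeoMax.dinv D)))
    ×
    (Σ[ rot ∈ Bijection (DeoMax-setoid n) (DeoMax-setoid n) ]
    ((∀ (D : DeoMax n) → filling (to rot D) ≡ rotate180 (filling D)) ×
    (∀ (D : DeoMax n) → (DeoMax.area D , DeoMax.dinv D) ≡ (DeoMax.dinv (to rot D) , DeoMax.area (to rot D)))))
theorem7p7 (suc (suc (suc l))) (s≤s (s≤s (s≤s _))) ¬2∣n
  -- The width n - 2 has the parity of n, hence is of the form 2k + 1.
  with k , refl ← odd (suc l) (¬2∣n ∘ ∣m∣n⇒∣m+n ∣-refl) =
  (deoToDyck k , λ D → deoToDyck-area k D , deoToDyck-dinv k D) ,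
  (rotation _ , (λ _ → refl) , rotation-stats)
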